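{- The variety $\mathsf V(\mathbf C_4)$ generated by the (noncommutative) four-element idempotent residuated chain $\mathbf C_4$ has the amalgamation property.
   Context: A residuated lattice is an algebra $\mathbf A=\langle A,\wedge,\vee,\cdot,\backslash,/,\mathrm e\rangle$ such that $\langle A,\wedge,\vee\rangle$ is a lattice, $\langle A,\cdot,\mathrm e\rangle$ is a monoid, and for all $a,b,c\in A$: $b\le a\backslash c\iff a\cdot b\le c\iff a\le c/b$. $\mathbf C_4$ is the residuated lattice with universe $\{\bot,c,\mathrm e,c^\sharp\}$, lattice order the chain $\bot<c<\mathrm e<c^\sharp$, identity $\mathrm e$, and product given by $x\cdot\bot=\bot\cdot x=\bot$ for all $x$, $c\cdot c=c$, $c^\sharp\cdot c^\sharp=c^\sharp$, $c\cdot c^\sharp=c$, $c^\sharp\cdot c=c^\sharp$; the residuals are determined by the product and the order. A class $\mathsf K$ of algebras has the amalgamation property if for all $\mathbf A,\mathbf B,\mathbf C\in\mathsf K$ and embeddings $i_1\colon\mathbf A\to\mathbf B$, $i_2\colon\mathbf A\to\mathbf C$, there exist $\mathbf D\in\mathsf K$ and embeddings $j_1\colon\mathbf B\to\mathbf D$, $j_2\colon\mathbf C\to\mathbf D$ with $j_1\circ i_1=j_2\circ i_2$. -}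

module Defs where

open import Algebra.Core using (Op₂)
import Algebra.Construct.NaturalChoice.Max as Max
import Algebra.Construct.NaturalChoice.Min as Min
import Algebra.Lattice.Construct.NaturalChoice.MinMaxOp as MinMaxOp
open import Algebra.Lattice.Structures using (IsLattice)
import Algebra.Morphism.Definitions as MorphismDefinitions
open import Algebra.Structures using (IsMonoid)
open import Data.Fin.Base using (Fin)
open import Data.Fin.Patterns using (0F; 1F; 2F; 3F)
open import Data.Fin.Properties using (_≟_; all?; ≤-totalOrder)
open import Data.Nat.Base using (ℕ)
open import Data.Product.Base using (Σ-syntax; _×_; _,_)
open import Function.Base using (_∘_)
open import Function.Bundles using (_⇔_; mk⇔; module Equivalence)
open import Level using (Level; 0ℓ; suc; _⊔_)
open import Relation.Binary.Core using (Rel)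
import Relation.Binary.Construct.NaturalOrder.Left as NaturalOrder
open import Relation.Binary.Morphism.Structures using (IsRelMonomorphism)
open import Relation.Binary.PropositionalEquality.Core using (_≡_; cong₂)
open import Relation.Binary.PropositionalEquality.Properties using (isEquivalence)
open import Relation.Nullary.Decidable.Core
  using (Dec; from-yes; map′; _×-dec_; _→-dec_)
open import Relation.Unary using (Pred; _∈_; _⊆_)

private
  variable
    a b ℓ ℓ₁ ℓ₂ p : Level

------------------------------------------------------------------------
-- Residuated lattices

-- Congruence of the two residuals is not a field: it follows from the
-- residuation laws by antisymmetry.
record ResiduatedLattice a ℓ : Set (suc (a ⊔ ℓ)) where
  infix  4 _≈_
  infixl 8 _∙_
  infixr 7 _\\_
  infixl 7 _//_
  infixr 6 _∧_
  infixr 5 _∨_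
  field
    Carrier : Set a
    _≈_     : Rel Carrier ℓ
    _∧_     : Op₂ Carrier
    _∨_     : Op₂ Carrier
    _∙_     : Op₂ Carrier
    _\\_    : Op₂ Carrier
    _//_    : Op₂ Carrier
    ε       : Carrier

  -- x ≤ y unfolds to x ≈ x ∧ y.
  open NaturalOrder _≈_ _∧_ public using (_≤_)

  field
    isLattice     : IsLattice _≈_ _∨_ _∧_
    isMonoid      : IsMonoid _≈_ _∙_ ε
    \\-residuated : ∀ x y z → (y ≤ x \\ z) ⇔ (x ∙ y ≤ z)
    //-residuated : ∀ x y z → (x ∙ y ≤ z) ⇔ (x ≤ z // y)

------------------------------------------------------------------------
-- Embeddings

module _ (A : ResiduatedLattice a ℓ₁) (B : ResiduatedLattice b ℓ₂) where
  private
    module A = ResiduatedLattice A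
    module B = ResiduatedLattice B
  open MorphismDefinitions A.Carrier B.Carrier B._≈_

  record IsEmbedding (f : A.Carrier → B.Carrier) : Set (a ⊔ ℓ₁ ⊔ ℓ₂) where
    field
      isRelMonomorphism : IsRelMonomorphism A._≈_ B._≈_ f
      ∧-homo            : Homomorphic₂ f A._∧_ B._∧_
      ∨-homo            : Homomorphic₂ f A._∨_ B._∨_
      ∙-homo            : Homomorphic₂ f A._∙_ B._∙_
      \\-homo           : Homomorphic₂ f A._\\_ B._\\_
      //-homo           : Homomorphic₂ f A._//_ B._//_
      ε-homo            : Homomorphic₀ f A.ε B.ε

    open IsRelMonomorphism isRelMonomorphism public

  record Embedding : Set (a ⊔ b ⊔ ℓ₁ ⊔ ℓ₂) where
    field
      ⟦_⟧         : A.Carrier → B.Carrier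
      isEmbedding : IsEmbedding ⟦_⟧

    open IsEmbedding isEmbedding public

------------------------------------------------------------------------
-- The amalgamation property

AmalgamationProperty : Pred (ResiduatedLattice a ℓ) p → Set (suc (a ⊔ ℓ) ⊔ p)
AmalgamationProperty {a} {ℓ} K =
  (A B C : ResiduatedLattice a ℓ) → A ∈ K → B ∈ K → C ∈ K →
  (i₁ : Embedding A B) (i₂ : Embedding A C) →
  Σ[ D ∈ ResiduatedLattice a ℓ ]
    D ∈ K ×
    Σ[ j₁ ∈ Embedding B D ] Σ[ j₂ ∈ Embedding C D ]
      let open ResiduatedLattice D using (_≈_)
          open Embedding using (⟦_⟧)
      in ∀ x → (⟦ j₁ ⟧ ∘ ⟦ i₁ ⟧) x ≈ (⟦ j₂ ⟧ ∘ ⟦ i₂ ⟧) x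

------------------------------------------------------------------------
-- Equations and varieties

infixl 8 _∙ₜ_
infixr 7 _\\ₜ_
infixl 7 _//ₜ_
infixr 6 _∧ₜ_
infixr 5 _∨ₜ_

data Term : Set where
  var                        : ℕ → Term
  _∧ₜ_ _∨ₜ_ _∙ₜ_ _\\ₜ_ _//ₜ_ : Term → Term → Term
  εₜ                         : Term

Equation : Set
Equation = Term × Term

module _ (A : ResiduatedLattice a ℓ) where
  open ResiduatedLattice A

  eval : (ℕ → Carrier) → Term → Carrier
  eval ρ (var n)   = ρ n
  eval ρ (s ∧ₜ t)  = eval ρ s ∧ eval ρ t
  eval ρ (s ∨ₜ t)  = eval ρ s ∨ eval ρ t
  eval ρ (s ∙ₜ t)  = eval ρ s ∙ eval ρ t
  eval ρ (s \\ₜ t) = eval ρ s \\ eval ρ t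
  eval ρ (s //ₜ t) = eval ρ s // eval ρ t
  eval ρ εₜ        = ε

  Satisfies : Pred Equation (a ⊔ ℓ)
  Satisfies (s , t) = ∀ ρ → eval ρ s ≈ eval ρ t

-- The variety axiomatised (relative to residuated lattices, themselves
-- a variety) by a set of equations.
Mod : Pred Equation 0ℓ → Pred (ResiduatedLattice a ℓ) (a ⊔ ℓ)
Mod E A = E ⊆ Satisfies A

-- The least variety containing G, i.e. the intersection of all
-- varieties Mod E having G as a member.
V : ResiduatedLattice b ℓ₂ → Pred (ResiduatedLattice a ℓ) (suc 0ℓ ⊔ a ⊔ b ⊔ ℓ ⊔ ℓ₂)
V G A = (E : Pred Equation 0ℓ) → G ∈ Mod E → A ∈ Mod E

------------------------------------------------------------------------
-- The four-element chain

module C₄ where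

  private
    module ⊓ = Min (≤-totalOrder 4)
    module ⊔ = Max (≤-totalOrder 4)

  -- The lattice order is the usual order of Fin 4.
  pattern bot = 0F
  pattern c   = 1F
  pattern e   = 2F
  pattern c♯  = 3F

  infixl 8 _∙_
  infixr 7 _\\_
  infixl 7 _//_

  _∧_ _∨_ _∙_ _\\_ _//_ : Op₂ (Fin 4)

  _∧_ = ⊓._⊓_
  _∨_ = ⊔._⊔_

  bot ∙ y   = bot
  e   ∙ y   = y
  c   ∙ bot = bot
  c   ∙ c   = c
  c   ∙ e   = c
  c   ∙ c♯  = c
  c♯  ∙ bot = bot
  c♯  ∙ c   = c♯
  c♯  ∙ e   = c♯
  c♯  ∙ c♯  = c♯

  -- x \\ z is the greatest y with x ∙ y ≤ z.
  bot \\ z   = c♯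
  e   \\ z   = z
  c   \\ bot = bot
  c   \\ c   = c♯
  c   \\ e   = c♯
  c   \\ c♯  = c♯
  c♯  \\ bot = bot
  c♯  \\ c   = bot
  c♯  \\ e   = bot
  c♯  \\ c♯  = c♯

  -- z // y is the greatest x with x ∙ y ≤ z.
  z   // bot = c♯
  z   // e   = z
  bot // c   = bot
  c   // c   = e
  e   // c   = e
  c♯  // c   = c♯
  bot // c♯  = bot
  c   // c♯  = c
  e   // c♯  = c
  c♯  // c♯  = c♯

  open NaturalOrder (_≡_ {A = Fin 4}) _∧_ using (_≤_)

  isLattice : IsLattice _≡_ _∨_ _∧_
  isLattice = MinMaxOp.⊔-⊓-isLattice ⊓.minOperator ⊔.maxOperator

  isMonoid : IsMonoid _≡_ _∙_ e
  isMonoid = record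
    { isSemigroup = record
      { isMagma = record { isEquivalence = isEquivalence ; ∙-cong = cong₂ _∙_ }
      ; assoc   = from-yes (all? λ x → all? λ y → all? λ z →
                    ((x ∙ y) ∙ z) ≟ (x ∙ (y ∙ z)))
      }
    ; identity = from-yes (all? (λ x → (e ∙ x) ≟ x) ×-dec all? (λ x → (x ∙ e) ≟ x))
    }

  private
    _≤?_ : ∀ x y → Dec (x ≤ y)
    x ≤? y = x ≟ (x ∧ y)

    _⇔-dec_ : ∀ {P : Set} {Q : Set} → Dec P → Dec Q → Dec (P ⇔ Q)
    P? ⇔-dec Q? = map′ (λ (f , g) → mk⇔ f g) (λ h → let open Equivalence h in to , from)
                       ((P? →-dec Q?) ×-dec (Q? →-dec P?))

  \\-residuated : ∀ x y z → (y ≤ x \\ z) ⇔ (x ∙ y ≤ z)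
  \\-residuated = from-yes (all? λ x → all? λ y → all? λ z →
    (y ≤? (x \\ z)) ⇔-dec ((x ∙ y) ≤? z))

  //-residuated : ∀ x y z → (x ∙ y ≤ z) ⇔ (x ≤ z // y)
  //-residuated = from-yes (all? λ x → all? λ y → all? λ z →
    ((x ∙ y) ≤? z) ⇔-dec (x ≤? (z // y)))

C₄ : ResiduatedLattice 0ℓ 0ℓ
C₄ = record { C₄ ; Carrier = Fin 4 ; _≈_ = _≡_ ; ε = C₄.e }

-- C₄ is quasi-primal: every relation on C₄ containing (e , … , e) is the solution set of an equation
-- p ≈ ε. Hence quasi-identities valid in C₄ hold throughout V(C₄), and existentially quantified
-- variables can be eliminated from such equations.
--
-- The amalgam of B and C over A consists of C₄-valued functions of the values of finitely many
-- named elements of B and C; two functions are identified when they agree on all C₄-valuations of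
-- some finite theory consisting of one equation true in B and one equation true in C, which share
-- names for finitely many elements of A. The embeddings are injective by interpolation: eliminating
-- the names of C from its equation leaves an equation about A, which holds in A and thus in B, and
-- then a quasi-identity of C₄ yields the desired equality in B.
module Submission where

open import Defs
open import Algebra.Core using (Op₂)
open import Algebra.Lattice.Bundles using (Lattice)
import Algebra.Lattice.Properties.Lattice as LatticeProperties
open import Algebra.Lattice.Structures using (IsLattice)
open import Algebra.Structures using (IsMonoid)
open import Data.Bool.Base using (Bool; true; false; not)
import Data.Bool.Properties as Bool
open import Data.Fin.Base using (Fin; zero; suc; toℕ; fromℕ<)
open import Data.Fin.Patterns using (0F; 1F; 2F; 3F)
open import Data.Fin.Properties using (_≟_; all?; toℕ-fromℕ<)
open import Data.Nat.Base using (ℕ; zero; suc; _≤_) renaming (_⊔_ to _⊔ₙ_)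
open import Data.Nat.Properties using (m≤m⊔n; m≤n⊔m; m⊔n≤o⇒m≤o; m⊔n≤o⇒n≤o)
open import Data.Product.Base using (Σ-syntax; ∃-syntax; _×_; _,_; proj₁; proj₂)
open import Data.Sum.Base using (_⊎_; inj₁; inj₂; [_,_]; assocʳ) renaming (map to map⊎)
open import Function.Base using (_∘_; id)
open import Function.Bundles using (_⇔_; mk⇔; module Equivalence)
open import Level using (Level; _⊔_)
open import Relation.Binary.PropositionalEquality
  using (_≡_; refl; sym; trans; cong; cong₂; subst₂)
open import Relation.Binary.Structures using (IsEquivalence)
open import Relation.Nullary.Decidable using (yes; no; from-yes; _×-dec_; _⊎-dec_; _→-dec_)
open import Relation.Nullary.Negation using (contradiction)
open import Relation.Unary using (_∈_)

private
  variable
    a ℓ : Level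
    M N : Set
    k : ℕ

-- Terms over an arbitrary set of names

data BinOp : Set where
  meet join mult under over : BinOp

data Tm (N : Set) : Set where
  var : N → Tm N
  op  : BinOp → Tm N → Tm N → Tm N
  one : Tm N

bind : Tm M → (M → Tm N) → Tm N
bind (var m)    g = g m
bind (op o s t) g = op o (bind s g) (bind t g)
bind one        g = one

rename : (M → N) → Tm M → Tm N
rename f t = bind t (var ∘ f)

fold : {X : Set a} → (BinOp → Op₂ X) → X → (N → X) → Tm N → X
fold f u ρ (var n)    = ρ n
fold f u ρ (op o s t) = f o (fold f u ρ s) (fold f u ρ t)
fold f u ρ one        = u

fold-bind : {X : Set a} (f : BinOp → Op₂ X) (u : X) (ρ : N → X) (t : Tm M) (g : M → Tm N) →
            fold f u ρ (bind t g) ≡ fold f u (λ m → fold f u ρ (g m)) t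
fold-bind f u ρ (var m)    g = refl
fold-bind f u ρ (op o s t) g = cong₂ (f o) (fold-bind f u ρ s g) (fold-bind f u ρ t g)
fold-bind f u ρ one        g = refl

fold-congᵒ : {X : Set a} {f g : BinOp → Op₂ X} → (∀ o x y → f o x y ≡ g o x y) →
             (u : X) (ρ : N → X) (t : Tm N) → fold f u ρ t ≡ fold g u ρ t
fold-congᵒ f≗g u ρ (var n) = refl
fold-congᵒ {f = f} f≗g u ρ (op o s t) =
  trans (cong₂ (f o) (fold-congᵒ f≗g u ρ s) (fold-congᵒ f≗g u ρ t)) (f≗g o _ _)
fold-congᵒ f≗g u ρ one = refl

operation : (X : ResiduatedLattice a ℓ) → BinOp → Op₂ (ResiduatedLattice.Carrier X)
operation X meet  = ResiduatedLattice._∧_ X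
operation X join  = ResiduatedLattice._∨_ X
operation X mult  = ResiduatedLattice._∙_ X
operation X under = ResiduatedLattice._\\_ X
operation X over  = ResiduatedLattice._//_ X

evalₜ : (X : ResiduatedLattice a ℓ) → let open ResiduatedLattice X in (N → Carrier) → Tm N → Carrier
evalₜ X = fold (operation X) (ResiduatedLattice.ε X)

eval₄ : (N → Fin 4) → Tm N → Fin 4
eval₄ = evalₜ C₄

-- Translation to and from terms with numbered variables

toTerm : (N → ℕ) → Tm N → Term
toTerm f (var n)        = var (f n)
toTerm f (op meet s t)  = toTerm f s ∧ₜ toTerm f t
toTerm f (op join s t)  = toTerm f s ∨ₜ toTerm f t
toTerm f (op mult s t)  = toTerm f s ∙ₜ toTerm f t
toTerm f (op under s t) = toTerm f s \\ₜ toTerm f t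
toTerm f (op over s t)  = toTerm f s //ₜ toTerm f t
toTerm f one            = εₜ

eval-toTerm : (X : ResiduatedLattice a ℓ) (ρ : ℕ → ResiduatedLattice.Carrier X) (f : N → ℕ) (t : Tm N) →
              eval X ρ (toTerm f t) ≡ evalₜ X (ρ ∘ f) t
eval-toTerm X ρ f (var n)        = refl
eval-toTerm X ρ f (op meet s t)  = cong₂ (operation X meet) (eval-toTerm X ρ f s) (eval-toTerm X ρ f t)
eval-toTerm X ρ f (op join s t)  = cong₂ (operation X join) (eval-toTerm X ρ f s) (eval-toTerm X ρ f t)
eval-toTerm X ρ f (op mult s t)  = cong₂ (operation X mult) (eval-toTerm X ρ f s) (eval-toTerm X ρ f t)
eval-toTerm X ρ f (op under s t) = cong₂ (operation X under) (eval-toTerm X ρ f s) (eval-toTerm X ρ f t)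
eval-toTerm X ρ f (op over s t)  = cong₂ (operation X over) (eval-toTerm X ρ f s) (eval-toTerm X ρ f t)
eval-toTerm X ρ f one            = refl

bound : Term → ℕ
bound (var n)  = suc n
bound (s ∧ₜ t)  = bound s ⊔ₙ bound t
bound (s ∨ₜ t)  = bound s ⊔ₙ bound t
bound (s ∙ₜ t)  = bound s ⊔ₙ bound t
bound (s \\ₜ t) = bound s ⊔ₙ bound t
bound (s //ₜ t) = bound s ⊔ₙ bound t
bound εₜ       = 0

-- A theory of the amalgam has only finitely many names, so an equation can be checked there only
-- when its variables range over some `Fin k`.
fromTerm : (t : Term) → bound t ≤ k → Σ[ t′ ∈ Tm (Fin k) ] toTerm toℕ t′ ≡ t
fromTerm-op : ∀ {f : Term → Term → Term} o →
              (∀ s′ t′ → toTerm {Fin k} toℕ (op o s′ t′) ≡ f (toTerm toℕ s′) (toTerm toℕ t′)) →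
              ∀ s t → bound s ⊔ₙ bound t ≤ k → Σ[ t′ ∈ Tm (Fin k) ] toTerm toℕ t′ ≡ f s t

fromTerm (var n)  n<k = var (fromℕ< n<k) , cong var (toℕ-fromℕ< n<k)
fromTerm (s ∧ₜ t)  le  = fromTerm-op meet (λ _ _ → refl) s t le
fromTerm (s ∨ₜ t)  le  = fromTerm-op join (λ _ _ → refl) s t le
fromTerm (s ∙ₜ t)  le  = fromTerm-op mult (λ _ _ → refl) s t le
fromTerm (s \\ₜ t) le  = fromTerm-op under (λ _ _ → refl) s t le
fromTerm (s //ₜ t) le  = fromTerm-op over (λ _ _ → refl) s t le
fromTerm εₜ       _   = one , refl

fromTerm-op {f = f} o homo s t le =
  let s′ , s′≡s = fromTerm s (m⊔n≤o⇒m≤o _ _ le)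
      t′ , t′≡t = fromTerm t (m⊔n≤o⇒n≤o _ _ le)
  in op o s′ t′ , trans (homo s′ t′) (cong₂ f s′≡s t′≡t)

extendFin : {X : Set a} → X → (Fin k → X) → ℕ → X
extendFin {k = zero}  x ρ n       = x
extendFin {k = suc k} x ρ zero    = ρ zero
extendFin {k = suc k} x ρ (suc n) = extendFin x (ρ ∘ suc) n

extendFin-toℕ : {X : Set a} (x : X) (ρ : Fin k → X) → ∀ i → extendFin x ρ (toℕ i) ≡ ρ i
extendFin-toℕ x ρ zero    = refl
extendFin-toℕ x ρ (suc i) = extendFin-toℕ x (ρ ∘ suc) i

-- Finite sets of names

infix  7 _≐_
infixr 6 _⊕_

data Shape : Set where
  _≐_ : Bool → Bool → Shape
  _⊕_ : Shape → Shape → Shape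

-- An element of side s is named by the leaf r ≐ s on side r, so that it has the name refl on its own
-- side and none on the other; true ≐ false serves as the empty shape.
El : Shape → Set
El (r ≐ s) = r ≡ s
El (S ⊕ T) = El S ⊎ El T

double : ℕ → ℕ
double zero    = zero
double (suc n) = suc (suc (double n))

interleave : {X : Set a} → (ℕ → X) → (ℕ → X) → ℕ → X
interleave f g zero    = f zero
interleave f g (suc n) = interleave g (f ∘ suc) n

-- This covers the odd positions too: `interleave` swaps its sequences at each step, so position
-- `suc (double n)` of `interleave f g` is position `double n` of `interleave g (f ∘ suc)`.
interleave-double : {X : Set a} (f g : ℕ → X) → ∀ n → interleave f g (double n) ≡ f n
interleave-double f g zero    = refl
interleave-double f g (suc n) = interleave-double (f ∘ suc) (g ∘ suc) n

encode : ∀ S → El S → ℕ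
encode (r ≐ s) _        = zero
encode (S ⊕ T) (inj₁ n) = double (encode S n)
encode (S ⊕ T) (inj₂ n) = suc (double (encode T n))

extend : {X : Set a} → ∀ S → X → (El S → X) → ℕ → X
extend (r ≐ s) x ρ _ with r Bool.≟ s
... | yes p = ρ p
... | no  _ = x
extend (S ⊕ T) x ρ = interleave (extend S x (ρ ∘ inj₁)) (extend T x (ρ ∘ inj₂))

extend-encode : {X : Set a} → ∀ S (x : X) ρ n → extend S x ρ (encode S n) ≡ ρ n
extend-encode (r ≐ s) x ρ refl with r Bool.≟ r
... | yes refl = refl
... | no  r≢r  = contradiction refl r≢r
extend-encode (S ⊕ T) x ρ (inj₁ n) =
  trans (interleave-double _ _ (encode S n)) (extend-encode S x (ρ ∘ inj₁) n)
extend-encode (S ⊕ T) x ρ (inj₂ n) =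
  trans (interleave-double _ _ (encode T n)) (extend-encode T x (ρ ∘ inj₂) n)

-- Definable operations on C₄

-- On `C₄` this is the indicator of `e`, with `bot` as false: `under x x` is `c♯` unless `x` is `e`,
-- and `under c♯ e` is `bot`.
β : Tm N → Tm N
β t = op under (op under t t) one

-- Connectives for the truth values `e` and `bot`. In `eq`, `e` lies below both residuals exactly
-- when `s ≤ t` and `t ≤ s`; the meet with `one` is then `e`, and otherwise `β` sends it to `bot`.
and or eq : Tm N → Tm N → Tm N
and s t = op meet (β s) (β t)
or  s t = op join (β s) (β t)
eq  s t = β (op meet (op meet (op under s t) (op under t s)) one)

private
  -- The value of a definable operation computes to a function of the values of its arguments, so
  -- each property below is a finite check over `Fin 4`.
  β₄ : Fin 4 → Fin 4
  β₄ x = eval₄ (λ (_ : Fin 1) → x) (β (var 0F))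

  two : Fin 4 → Fin 4 → Fin 2 → Fin 4
  two x y 0F = x
  two x y 1F = y

  and₄ or₄ eq₄ : Fin 4 → Fin 4 → Fin 4
  and₄ x y = eval₄ (two x y) (and (var 0F) (var 1F))
  or₄  x y = eval₄ (two x y) (or (var 0F) (var 1F))
  eq₄  x y = eval₄ (two x y) (eq (var 0F) (var 1F))

-- Abstract because the decision procedures are costly to unfold.
abstract
  β-values : (σ : N → Fin 4) (p : Tm N) → eval₄ σ p ≡ C₄.e ⊎ eval₄ σ (β p) ≡ C₄.bot
  β-values σ p = from-yes (all? λ x → (x ≟ C₄.e) ⊎-dec (β₄ x ≟ C₄.bot)) (eval₄ σ p)

  and-elim : (σ : N → Fin 4) (p q : Tm N) →
             eval₄ σ (and p q) ≡ C₄.e → eval₄ σ p ≡ C₄.e × eval₄ σ q ≡ C₄.e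
  and-elim σ p q = from-yes (all? λ x → all? λ y →
    (and₄ x y ≟ C₄.e) →-dec ((x ≟ C₄.e) ×-dec (y ≟ C₄.e))) (eval₄ σ p) (eval₄ σ q)

  and-e : (σ : N → Fin 4) (p q : Tm N) → eval₄ σ q ≡ C₄.e → eval₄ σ (and p q) ≡ eval₄ σ (β p)
  and-e σ p q = from-yes (all? λ x → all? λ y →
    (y ≟ C₄.e) →-dec (and₄ x y ≟ β₄ x)) (eval₄ σ p) (eval₄ σ q)

  or-elim : (σ : N → Fin 4) (p q : Tm N) →
            eval₄ σ (or p q) ≡ C₄.e → eval₄ σ p ≡ C₄.e ⊎ eval₄ σ q ≡ C₄.e
  or-elim σ p q = from-yes (all? λ x → all? λ y →
    (or₄ x y ≟ C₄.e) →-dec ((x ≟ C₄.e) ⊎-dec (y ≟ C₄.e))) (eval₄ σ p) (eval₄ σ q)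

  or-intro : (σ : N → Fin 4) (p q : Tm N) →
             eval₄ σ p ≡ C₄.e ⊎ eval₄ σ q ≡ C₄.e → eval₄ σ (or p q) ≡ C₄.e
  or-intro σ p q = from-yes (all? λ x → all? λ y →
    ((x ≟ C₄.e) ⊎-dec (y ≟ C₄.e)) →-dec (or₄ x y ≟ C₄.e)) (eval₄ σ p) (eval₄ σ q)

  eq-elim : (σ : N → Fin 4) (p q : Tm N) → eval₄ σ (eq p q) ≡ C₄.e → eval₄ σ p ≡ eval₄ σ q
  eq-elim σ p q = from-yes (all? λ x → all? λ y →
    (eq₄ x y ≟ C₄.e) →-dec (x ≟ y)) (eval₄ σ p) (eval₄ σ q)

  eq-refl : (σ : N → Fin 4) (p : Tm N) → eval₄ σ (eq p p) ≡ C₄.e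
  eq-refl σ p = from-yes (all? λ x → eq₄ x x ≟ C₄.e) (eval₄ σ p)

-- Identities that together express residuation.
abstract
  \\-counit : ∀ x y z → let t = x C₄.∙ (y C₄.∧ (x C₄.\\ z)) in t ≡ t C₄.∧ z
  \\-counit = from-yes (all? λ x → all? λ y → all? λ z →
    let t = x C₄.∙ (y C₄.∧ (x C₄.\\ z)) in t ≟ (t C₄.∧ z))

  \\-unit : ∀ x y → y ≡ y C₄.∧ (x C₄.\\ (x C₄.∙ y))
  \\-unit = from-yes (all? λ x → all? λ y → y ≟ (y C₄.∧ (x C₄.\\ (x C₄.∙ y))))

  \\-mono-∧ : ∀ x y z → let t = y C₄.∧ (x C₄.\\ ((x C₄.∙ y) C₄.∧ z)) in t ≡ t C₄.∧ (x C₄.\\ z)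
  \\-mono-∧ = from-yes (all? λ x → all? λ y → all? λ z →
    let t = y C₄.∧ (x C₄.\\ ((x C₄.∙ y) C₄.∧ z)) in t ≟ (t C₄.∧ (x C₄.\\ z)))

  //-counit : ∀ x y z → let t = (x C₄.∧ (z C₄.// y)) C₄.∙ y in t ≡ t C₄.∧ z
  //-counit = from-yes (all? λ x → all? λ y → all? λ z →
    let t = (x C₄.∧ (z C₄.// y)) C₄.∙ y in t ≟ (t C₄.∧ z))

  //-unit : ∀ x y → x ≡ x C₄.∧ ((x C₄.∙ y) C₄.// y)
  //-unit = from-yes (all? λ x → all? λ y → x ≟ (x C₄.∧ ((x C₄.∙ y) C₄.// y)))

  //-mono-∧ : ∀ x y z → let t = x C₄.∧ (((x C₄.∙ y) C₄.∧ z) C₄.// y) in t ≡ t C₄.∧ (z C₄.// y)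
  //-mono-∧ = from-yes (all? λ x → all? λ y → all? λ z →
    let t = x C₄.∧ (((x C₄.∙ y) C₄.∧ z) C₄.// y) in t ≟ (t C₄.∧ (z C₄.// y)))

-- The element `e` is idempotent for all five operations and so forms a subalgebra. This is why a
-- relation defined by an equation `p ≈ ε` contains the tuple of all `e`.
eval₄-e : (σ : N → Fin 4) → (∀ n → σ n ≡ C₄.e) → ∀ t → eval₄ σ t ≡ C₄.e
eval₄-e σ σ≡e (var n) = σ≡e n
eval₄-e σ σ≡e (op o s t) =
  trans (cong₂ (operation C₄ o) (eval₄-e σ σ≡e s) (eval₄-e σ σ≡e t)) (idem o)
  where
  idem : ∀ o → operation C₄ o C₄.e C₄.e ≡ C₄.e
  idem meet = refl
  idem join = refl
  idem mult = refl
  idem under = refl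
  idem over = refl
eval₄-e σ σ≡e one = refl

every : ∀ S → (El S → Tm N) → Tm N
every (r ≐ s) f with r Bool.≟ s
... | yes p = f p
... | no  _ = one
every (S ⊕ T) f = and (every S (f ∘ inj₁)) (every T (f ∘ inj₂))

every-elim : ∀ S (f : El S → Tm N) (σ : N → Fin 4) → eval₄ σ (every S f) ≡ C₄.e →
             ∀ n → eval₄ σ (f n) ≡ C₄.e
every-elim (r ≐ s) f σ h refl with r Bool.≟ r
... | yes refl = h
... | no  r≢r  = contradiction refl r≢r
every-elim (S ⊕ T) f σ h (inj₁ n) =
  every-elim S (f ∘ inj₁) σ (proj₁ (and-elim σ (every S (f ∘ inj₁)) (every T (f ∘ inj₂)) h)) n
every-elim (S ⊕ T) f σ h (inj₂ n) =
  every-elim T (f ∘ inj₂) σ (proj₂ (and-elim σ (every S (f ∘ inj₁)) (every T (f ∘ inj₂)) h)) n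

-- Elements of the variety

module Properties (X : ResiduatedLattice a ℓ) where
  open ResiduatedLattice X renaming (_≤_ to _≤ₓ_)
  open IsLattice isLattice public
    using (∧-cong; ∨-cong; ∧-comm)
    renaming (refl to ≈-refl; sym to ≈-sym; trans to ≈-trans; reflexive to ≈-reflexive)
  open IsMonoid isMonoid public using (∙-cong)

  lattice : Lattice _ _
  lattice = record { isLattice = isLattice }

  open LatticeProperties lattice using (∧-idem)

  \\-mono : ∀ {x x′ z z′} → x ≈ x′ → z ≈ z′ → x \\ z ≤ₓ x′ \\ z′
  \\-mono {x} {x′} {z} {z′} x≈x′ z≈z′ = Equivalence.from (\\-residuated x′ (x \\ z) z′)
    (≈-trans (∙-cong (≈-sym x≈x′) ≈-refl)
      (≈-trans (Equivalence.to (\\-residuated x (x \\ z) z) (≈-sym (∧-idem _)))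
        (∧-cong (∙-cong x≈x′ ≈-refl) z≈z′)))

  //-mono : ∀ {y y′ z z′} → y ≈ y′ → z ≈ z′ → z // y ≤ₓ z′ // y′
  //-mono {y} {y′} {z} {z′} y≈y′ z≈z′ = Equivalence.to (//-residuated (z // y) y′ z′)
    (≈-trans (∙-cong ≈-refl (≈-sym y≈y′))
      (≈-trans (Equivalence.from (//-residuated (z // y) y z) (≈-sym (∧-idem _)))
        (∧-cong (∙-cong ≈-refl y≈y′) z≈z′)))

  ≤-antisym : ∀ {x y} → x ≤ₓ y → y ≤ₓ x → x ≈ y
  ≤-antisym x≤y y≤x = ≈-trans x≤y (≈-trans (∧-comm _ _) (≈-sym y≤x))

  operation-cong : ∀ o {x x′ y y′} → x ≈ x′ → y ≈ y′ → operation X o x y ≈ operation X o x′ y′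
  operation-cong meet  p q = ∧-cong p q
  operation-cong join  p q = ∨-cong p q
  operation-cong mult  p q = ∙-cong p q
  operation-cong under p q = ≤-antisym (\\-mono p q) (\\-mono (≈-sym p) (≈-sym q))
  operation-cong over  p q = ≤-antisym (//-mono q p) (//-mono (≈-sym q) (≈-sym p))

  evalₜ-cong : {ρ ρ′ : N → Carrier} → (∀ n → ρ n ≈ ρ′ n) → ∀ t → evalₜ X ρ t ≈ evalₜ X ρ′ t
  evalₜ-cong ρ≈ρ′ (var n)    = ρ≈ρ′ n
  evalₜ-cong ρ≈ρ′ (op o s t) = operation-cong o (evalₜ-cong ρ≈ρ′ s) (evalₜ-cong ρ≈ρ′ t)
  evalₜ-cong ρ≈ρ′ one        = ≈-refl

  evalₜ-bind : {ρ : N → Carrier} {ρ′ : M → Carrier} (t : Tm M) (g : M → Tm N) →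
               (∀ m → evalₜ X ρ (g m) ≈ ρ′ m) → evalₜ X ρ (bind t g) ≈ evalₜ X ρ′ t
  evalₜ-bind {ρ = ρ} t g h =
    ≈-trans (≈-reflexive (fold-bind (operation X) ε ρ t g)) (evalₜ-cong h t)

  evalₜ-rename : {ρ : N → Carrier} {ρ′ : M → Carrier} (t : Tm M) (f : M → N) →
                 (∀ m → ρ (f m) ≈ ρ′ m) → evalₜ X ρ (rename f t) ≈ evalₜ X ρ′ t
  evalₜ-rename t f = evalₜ-bind t (var ∘ f)

open Properties C₄ using () renaming
  (evalₜ-cong to eval₄-cong; evalₜ-bind to eval₄-bind; evalₜ-rename to eval₄-rename)

module Variety (X : ResiduatedLattice a ℓ) (X∈V : X ∈ V C₄) where
  open ResiduatedLattice X renaming (_≤_ to _≤ₓ_)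
  open Properties X

  transfer : ∀ S (s t : Tm (El S)) → (∀ σ → eval₄ σ s ≡ eval₄ σ t) → ∀ ρ → evalₜ X ρ s ≈ evalₜ X ρ t
  transfer S s t s≡t ρ = ≈-trans (≈-sym (decode s)) (≈-trans holds (decode t))
    where
    ρ′ : ℕ → Carrier
    ρ′ = extend S ε ρ

    holds : eval X ρ′ (toTerm (encode S) s) ≈ eval X ρ′ (toTerm (encode S) t)
    -- Membership in `V C₄` is applied to the set of all identities of `C₄`.
    holds = X∈V (Satisfies C₄) id {toTerm (encode S) s , toTerm (encode S) t}
      (λ σ → trans (eval-toTerm C₄ σ (encode S) s)
        (trans (s≡t (σ ∘ encode S)) (sym (eval-toTerm C₄ σ (encode S) t))))
      ρ′

    decode : ∀ r → eval X ρ′ (toTerm (encode S) r) ≈ evalₜ X ρ r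
    decode r = ≈-trans (≈-reflexive (eval-toTerm X ρ′ (encode S) r))
      (evalₜ-cong (λ n → ≈-reflexive (extend-encode S ε ρ n)) r)

  β-≈ε : {S : Shape} (p : Tm (El S)) {ρ : El S → Carrier} → evalₜ X ρ p ≈ ε → evalₜ X ρ (β p) ≈ ε
  β-≈ε {S} p {ρ} p≈ε = ≈-trans
    (operation-cong under (operation-cong under p≈ε p≈ε) ≈-refl)
    (transfer S (β one) one (λ _ → refl) ρ)

  -- β p \\ q = β p \\ r is valid in C₄: where p ≢ e both sides are bot \\ _ = c♯.
  quasi-identity : ∀ S (p q r : Tm (El S)) →
                   (∀ σ → eval₄ σ p ≡ C₄.e → eval₄ σ q ≡ eval₄ σ r) →
                   ∀ ρ → evalₜ X ρ p ≈ ε → evalₜ X ρ q ≈ evalₜ X ρ r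
  quasi-identity S p q r p⇒q≡r ρ p≈ε =
    ≈-trans (≈-sym (unguard q)) (≈-trans (transfer S (guard q) (guard r) valid ρ) (unguard r))
    where
    guard : Tm (El S) → Tm (El S)
    guard = op under (β p)

    valid : ∀ σ → eval₄ σ (guard q) ≡ eval₄ σ (guard r)
    valid σ with β-values σ p
    ... | inj₁ p≡e   = cong (eval₄ σ (β p) C₄.\\_) (p⇒q≡r σ p≡e)
    ... | inj₂ β≡bot = trans (cong (C₄._\\ eval₄ σ q) β≡bot) (cong (C₄._\\ eval₄ σ r) (sym β≡bot))

    unguard : ∀ t → evalₜ X ρ (guard t) ≈ evalₜ X ρ t
    unguard t = ≈-trans (operation-cong under (β-≈ε p p≈ε) ≈-refl)
      (transfer S (op under one t) t (λ _ → refl) ρ)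

  -- `quasi-identity` takes a single premise, so the two are used in turn: where `q` is `e`,
  -- `and p q` agrees with `β p` on `C₄`, and `β p` is `ε` by the premise on `p`.
  and-≈ε : ∀ S (p q : Tm (El S)) {ρ : El S → Carrier} →
           evalₜ X ρ p ≈ ε → evalₜ X ρ q ≈ ε → evalₜ X ρ (and p q) ≈ ε
  and-≈ε S p q {ρ} p≈ε q≈ε =
    ≈-trans (quasi-identity S q (and p q) (β p) (λ σ → and-e σ p q) ρ q≈ε) (β-≈ε p p≈ε)

  eq-≈ε : ∀ S (p q : Tm (El S)) {ρ : El S → Carrier} →
          evalₜ X ρ p ≈ evalₜ X ρ q → evalₜ X ρ (eq p q) ≈ ε
  eq-≈ε S p q {ρ} p≈q = ≈-trans
    (operation-cong under (operation-cong under u u) ≈-refl)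
    (transfer S (eq q q) one (λ σ → eq-refl σ q) ρ)
    where
    u = ∧-cong (∧-cong (operation-cong under p≈q ≈-refl) (operation-cong under ≈-refl p≈q)) ≈-refl

  every-≈ε : ∀ T S (f : El S → Tm (El T)) {ρ : El T → Carrier} →
             (∀ n → evalₜ X ρ (f n) ≈ ε) → evalₜ X ρ (every S f) ≈ ε
  every-≈ε T (r ≐ s) f f≈ε with r Bool.≟ s
  ... | yes p = f≈ε p
  ... | no  _ = ≈-refl
  every-≈ε T (S ⊕ S′) f f≈ε =
    and-≈ε T (every S (f ∘ inj₁)) (every S′ (f ∘ inj₂))
      (every-≈ε T S (f ∘ inj₁) (f≈ε ∘ inj₁)) (every-≈ε T S′ (f ∘ inj₂) (f≈ε ∘ inj₂))

-- Elimination of names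

-- No closed term denotes `bot`, since `e` forms a subalgebra. This term does so as soon as some
-- name has a value other than `e`.
bottom : ∀ S → Tm (El S)
bottom S = β (every S var)

bottom-spec : ∀ S (σ : El S → Fin 4) → eval₄ σ (bottom S) ≡ C₄.bot ⊎ (∀ n → σ n ≡ C₄.e)
bottom-spec S σ with β-values σ (every S var)
... | inj₁ h = inj₂ (every-elim S var σ h)
... | inj₂ h = inj₁ h

-- Substituting bot for z turns these terms into constants.
value : Tm N → Fin 4 → Tm N
value z C₄.bot = z
value z C₄.c   = op over one (op under z z)
value z C₄.e   = one
value z C₄.c♯  = op under z z

value-bot : (σ : N → Fin 4) (z : Tm N) → eval₄ σ z ≡ C₄.bot → ∀ x → eval₄ σ (value z x) ≡ x
value-bot σ z z≡bot C₄.bot = z≡bot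
value-bot σ z z≡bot C₄.c   rewrite z≡bot = refl
value-bot σ z z≡bot C₄.e   = refl
value-bot σ z z≡bot C₄.c♯  rewrite z≡bot = refl

some : (Fin 4 → Tm N) → Tm N
some f = or (or (f 0F) (f 1F)) (or (f 2F) (f 3F))

some-intro : (σ : N → Fin 4) (f : Fin 4 → Tm N) → ∀ x → eval₄ σ (f x) ≡ C₄.e → eval₄ σ (some f) ≡ C₄.e
some-intro σ f x h = or-intro σ (or (f 0F) (f 1F)) (or (f 2F) (f 3F)) (half x h)
  where
  half : ∀ x → eval₄ σ (f x) ≡ C₄.e →
         eval₄ σ (or (f 0F) (f 1F)) ≡ C₄.e ⊎ eval₄ σ (or (f 2F) (f 3F)) ≡ C₄.e
  half 0F h = inj₁ (or-intro σ (f 0F) (f 1F) (inj₁ h))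
  half 1F h = inj₁ (or-intro σ (f 0F) (f 1F) (inj₂ h))
  half 2F h = inj₂ (or-intro σ (f 2F) (f 3F) (inj₁ h))
  half 3F h = inj₂ (or-intro σ (f 2F) (f 3F) (inj₂ h))

some-elim : (σ : N → Fin 4) (f : Fin 4 → Tm N) → eval₄ σ (some f) ≡ C₄.e → ∃[ x ] eval₄ σ (f x) ≡ C₄.e
some-elim σ f h with or-elim σ (or (f 0F) (f 1F)) (or (f 2F) (f 3F)) h
some-elim σ f h | inj₁ h′ with or-elim σ (f 0F) (f 1F) h′
... | inj₁ h″ = 0F , h″
... | inj₂ h″ = 1F , h″
some-elim σ f h | inj₂ h′ with or-elim σ (f 2F) (f 3F) h′
... | inj₁ h″ = 2F , h″
... | inj₂ h″ = 3F , h″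

instantiate : ∀ T → Tm (N ⊎ El T) → Fin 4 → Tm (El T)
instantiate T q x = bind q [ (λ _ → value (bottom T) x) , var ]

-- Quantifying over one value is a disjunction of four instances. In a sum, the names of `S′` serve
-- as parameters while those of `S` are eliminated, and are eliminated afterwards.
eliminate : ∀ S T → Tm (El S ⊎ El T) → Tm (El T)
eliminate (r ≐ s)  T q = some (instantiate T q)
eliminate (S ⊕ S′) T q = eliminate S′ T (eliminate S (S′ ⊕ T) (rename assocʳ q))

eliminate-intro : ∀ S T q (σ : El S → Fin 4) (τ : El T → Fin 4) →
                  eval₄ [ σ , τ ] q ≡ C₄.e → eval₄ τ (eliminate S T q) ≡ C₄.e
eliminate-intro (r ≐ s) T q σ τ h with bottom-spec T τ
... | inj₂ τ≡e   = eval₄-e τ τ≡e (eliminate (r ≐ s) T q)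
... | inj₁ z≡bot = some-intro τ (instantiate T q) x
  (trans (eval₄-bind {ρ′ = [ σ , τ ]} q _ agree) h)
  where
  leaf-value : Σ[ x ∈ Fin 4 ] (∀ p → σ p ≡ x)
  -- A leaf has at most one name, so `σ` takes a single value there; without a name, `0F` is an
  -- arbitrary choice.
  leaf-value with r Bool.≟ s
  ... | yes refl = σ refl , λ { refl → refl }
  ... | no  r≢s  = 0F , λ p → contradiction p r≢s

  x = proj₁ leaf-value

  agree : ∀ n → eval₄ τ ([ (λ _ → value (bottom T) x) , var ] n) ≡ [ σ , τ ] n
  agree (inj₁ p) = trans (value-bot τ (bottom T) z≡bot x) (sym (proj₂ leaf-value p))
  agree (inj₂ n) = refl
eliminate-intro (S ⊕ S′) T q σ τ h =
  eliminate-intro S′ T _ (σ ∘ inj₂) τ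
    (eliminate-intro S (S′ ⊕ T) _ (σ ∘ inj₁) [ σ ∘ inj₂ , τ ]
      (trans (eval₄-rename q assocʳ
        λ { (inj₁ (inj₁ _)) → refl ; (inj₁ (inj₂ _)) → refl ; (inj₂ _) → refl }) h))

-- The witness is the value of the term substituted in a true disjunct, whether or not `bottom T`
-- denotes `bot`.
eliminate-elim : ∀ S T q (τ : El T → Fin 4) → eval₄ τ (eliminate S T q) ≡ C₄.e →
                 Σ[ σ ∈ (El S → Fin 4) ] eval₄ [ σ , τ ] q ≡ C₄.e
eliminate-elim (r ≐ s) T q τ h =
  let x , h′ = some-elim τ (instantiate T q) h
  in (λ _ → eval₄ τ (value (bottom T) x)) ,
     trans (sym (eval₄-bind q [ (λ _ → value (bottom T) x) , var ] λ { (inj₁ _) → refl ; (inj₂ _) → refl })) h′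
eliminate-elim (S ⊕ S′) T q τ h =
  let σ′ , h′ = eliminate-elim S′ T _ τ h
      σ , h″ = eliminate-elim S (S′ ⊕ T) _ [ σ′ , τ ] h′
  in [ σ , σ′ ] , trans (sym (eval₄-rename q assocʳ
       λ { (inj₁ (inj₁ _)) → refl ; (inj₁ (inj₂ _)) → refl ; (inj₂ _) → refl })) h″

-- The amalgam

module Amalgam (A B C : ResiduatedLattice a ℓ) (B∈V : B ∈ V C₄) (C∈V : C ∈ V C₄)
               (i₁ : Embedding A B) (i₂ : Embedding A C) where

  T : Bool → ResiduatedLattice a ℓ
  T true  = B
  T false = C

  T∈V : ∀ s → T s ∈ V C₄
  T∈V true  = B∈V
  T∈V false = C∈V

  i : ∀ s → Embedding A (T s)
  i true  = i₁
  i false = i₂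

  module A = ResiduatedLattice A
  module T s = ResiduatedLattice (T s)
  module PT s = Properties (T s)
  module VT s = Variety (T s) (T∈V s)
  module I s = Embedding (i s)

  -- Contexts of named elements, their renamings, and theories

  record Ctx : Set a where
    field
      shape : Bool → Shape
      env   : ∀ s → El (shape s) → T.Carrier s

  open Ctx

  Val : Ctx → Set
  Val Γ = ∀ s → El (shape Γ s) → Fin 4

  record _⇒_ (Γ Δ : Ctx) : Set ℓ where
    field
      name     : ∀ s → El (shape Γ s) → El (shape Δ s)
      name-env : ∀ s n → let open T s in env Δ s (name s n) ≈ env Γ s n

  open _⇒_

  pull : ∀ {Γ Δ} → Γ ⇒ Δ → Val Δ → Val Γ
  pull m v s n = v s (name m s n)

  _∘⇒_ : ∀ {Γ Δ Θ} → Δ ⇒ Θ → Γ ⇒ Δ → Γ ⇒ Θ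
  name     (m ∘⇒ n) s x = name m s (name n s x)
  name-env (m ∘⇒ n) s x = PT.≈-trans s (name-env m s (name n s x)) (name-env n s x)

  ∅ : Ctx
  shape ∅ _ = true ≐ false
  env ∅ _ ()

  ∅⇒ : ∀ {Γ} → ∅ ⇒ Γ
  name ∅⇒ _ ()
  name-env ∅⇒ _ ()

  _⊞_ : Ctx → Ctx → Ctx
  shape (Γ ⊞ Δ) s = shape Γ s ⊕ shape Δ s
  env   (Γ ⊞ Δ) s = [ env Γ s , env Δ s ]

  inl : ∀ {Γ Δ} → Γ ⇒ (Γ ⊞ Δ)
  name     inl s   = inj₁
  name-env inl s n = PT.≈-refl s

  inr : ∀ {Γ Δ} → Δ ⇒ (Γ ⊞ Δ)
  name     inr s   = inj₂
  name-env inr s n = PT.≈-refl s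

  copair : ∀ {Γ Δ Θ} → Γ ⇒ Θ → Δ ⇒ Θ → (Γ ⊞ Δ) ⇒ Θ
  name     (copair m n) s          = [ name m s , name n s ]
  name-env (copair m n) s (inj₁ x) = name-env m s x
  name-env (copair m n) s (inj₂ x) = name-env n s x

  ⨁ : (Fin k → Ctx) → Ctx
  ⨁ {k = zero}  Γ = ∅
  ⨁ {k = suc k} Γ = Γ zero ⊞ ⨁ (Γ ∘ suc)

  inject : (Γ : Fin k → Ctx) → ∀ j → Γ j ⇒ ⨁ Γ
  inject Γ zero    = inl
  inject Γ (suc j) = inr ∘⇒ inject (Γ ∘ suc) j

  -- A theory has names for finitely many elements of B, of C and of A (the base names, usable on
  -- both sides), and one constraint per side that is true of the named elements.
  record Theory : Set (a ⊔ ℓ) where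
    field
      ctx   : Ctx
      base  : Shape
      benv  : El base → A.Carrier
    full : ∀ s → El (shape ctx s ⊕ base) → T.Carrier s
    full s = [ env ctx s , I.⟦_⟧ s ∘ benv ]
    field
      con   : ∀ s → Tm (El (shape ctx s ⊕ base))
      holds : ∀ s → let open T s in evalₜ (T s) (full s) (con s) ≈ ε

  open Theory

  -- The two constraints interact only through `bval`, the shared values of the base names.
  record Model (Δ : Theory) : Set where
    field
      val  : Val (ctx Δ)
      bval : El (base Δ) → Fin 4
      sat  : ∀ s → eval₄ [ val s , bval ] (con Δ s) ≡ C₄.e

  open Model

  constrained : (Γ : Ctx) (p : ∀ s → Tm (El (shape Γ s))) →
                (∀ s → let open T s in evalₜ (T s) (env Γ s) (p s) ≈ ε) → Theory
  ctx   (constrained Γ p h) = Γ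
  base  (constrained Γ p h) = true ≐ false
  benv  (constrained Γ p h) ()
  con   (constrained Γ p h) s = rename inj₁ (p s)
  holds (constrained Γ p h) s =
    PT.≈-trans s (PT.evalₜ-rename s (p s) inj₁ (λ _ → PT.≈-refl s)) (h s)

  constrained-sat : ∀ {Γ} p h (m : Model (constrained Γ p h)) → ∀ s → eval₄ (val m s) (p s) ≡ C₄.e
  constrained-sat p h m s = trans (sym (eval₄-rename (p s) inj₁ (λ _ → refl))) (sat m s)

  free : Ctx → Theory
  free Γ = constrained Γ (λ _ → one) (λ s → PT.≈-refl s)

  -- A model of `glue` restricts to models of both theories that agree on the names from `Γ`. The
  -- added equations are true of the named elements because `m₁` and `m₂` preserve the environment.
  module Glue (Γ : Ctx) (Δ₁ Δ₂ : Theory) (m₁ : Γ ⇒ ctx Δ₁) (m₂ : Γ ⇒ ctx Δ₂) where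

    private
      Θ : Bool → Shape
      Θ s = (shape (ctx Δ₁) s ⊕ shape (ctx Δ₂) s) ⊕ (base Δ₁ ⊕ base Δ₂)

      full′ : ∀ s → El (Θ s) → T.Carrier s
      full′ s = [ env (ctx Δ₁ ⊞ ctx Δ₂) s , I.⟦_⟧ s ∘ [ benv Δ₁ , benv Δ₂ ] ]

      left right : ∀ s → Tm (El (Θ s))
      left  s = rename (map⊎ inj₁ inj₁) (con Δ₁ s)
      right s = rename (map⊎ inj₂ inj₂) (con Δ₂ s)

      identify : ∀ s → El (shape Γ s) → Tm (El (Θ s))
      identify s n = eq (var (inj₁ (inj₁ (name m₁ s n)))) (var (inj₁ (inj₂ (name m₂ s n))))

      identified : ∀ s → Tm (El (Θ s))
      identified s = every (shape Γ s) (identify s)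

    glue : Theory
    ctx   glue = ctx Δ₁ ⊞ ctx Δ₂
    base  glue = base Δ₁ ⊕ base Δ₂
    benv  glue = [ benv Δ₁ , benv Δ₂ ]
    con   glue s = and (and (left s) (right s)) (identified s)
    holds glue s = VT.and-≈ε s (Θ s) (and (left s) (right s)) (identified s)
      (VT.and-≈ε s (Θ s) (left s) (right s)
        (≈-trans (evalₜ-rename {ρ = full′ s} {ρ′ = full Δ₁ s} (con Δ₁ s) (map⊎ inj₁ inj₁)
          λ { (inj₁ _) → ≈-refl ; (inj₂ _) → ≈-refl }) (holds Δ₁ s))
        (≈-trans (evalₜ-rename {ρ = full′ s} {ρ′ = full Δ₂ s} (con Δ₂ s) (map⊎ inj₂ inj₂)
          λ { (inj₁ _) → ≈-refl ; (inj₂ _) → ≈-refl }) (holds Δ₂ s)))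
      (VT.every-≈ε s (Θ s) (shape Γ s) (identify s) λ n →
        VT.eq-≈ε s (Θ s) (var (inj₁ (inj₁ (name m₁ s n)))) (var (inj₁ (inj₂ (name m₂ s n))))
          {full′ s} (≈-trans (name-env m₁ s n) (≈-sym (name-env m₂ s n))))
      where open PT s

    module _ (m : Model glue) where

      private
        σ : ∀ s → El (Θ s) → Fin 4
        σ s = [ val m s , bval m ]

        sat-both : ∀ s → eval₄ (σ s) (left s) ≡ C₄.e × eval₄ (σ s) (right s) ≡ C₄.e
        sat-both s = and-elim (σ s) (left s) (right s)
          (proj₁ (and-elim (σ s) (and (left s) (right s)) (identified s) (sat m s)))

      model₁ : Model Δ₁
      val  model₁ s = val m s ∘ inj₁
      bval model₁   = bval m ∘ inj₁
      sat  model₁ s = trans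
        (sym (eval₄-rename (con Δ₁ s) (map⊎ inj₁ inj₁) λ { (inj₁ _) → refl ; (inj₂ _) → refl }))
        (proj₁ (sat-both s))

      model₂ : Model Δ₂
      val  model₂ s = val m s ∘ inj₂
      bval model₂   = bval m ∘ inj₂
      sat  model₂ s = trans
        (sym (eval₄-rename (con Δ₂ s) (map⊎ inj₂ inj₂) λ { (inj₁ _) → refl ; (inj₂ _) → refl }))
        (proj₂ (sat-both s))

      models-agree : ∀ s n → pull m₁ (val model₁) s n ≡ pull m₂ (val model₂) s n
      models-agree s n = eq-elim (σ s)
        (var (inj₁ (inj₁ (name m₁ s n)))) (var (inj₁ (inj₂ (name m₂ s n)))) (every-elim (shape Γ s) (identify s) (σ s)
        (proj₂ (and-elim (σ s) (and (left s) (right s)) (identified s) (sat m s))) n)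

  -- Elements of the amalgam and their equality

  record Elem : Set a where
    no-eta-equality
    field
      names : Ctx
      fn    : Val names → Fin 4
      ext   : ∀ {v w} → (∀ s n → v s n ≡ w s n) → fn v ≡ fn w

  open Elem

  infix 4 _≃_

  record _≃_ (x y : Elem) : Set (a ⊔ ℓ) where
    field
      theory : Theory
      namesˡ : names x ⇒ ctx theory
      namesʳ : names y ⇒ ctx theory
      agree  : (m : Model theory) → fn x (pull namesˡ (val m)) ≡ fn y (pull namesʳ (val m))

  open _≃_

  ≃-refl : ∀ {x} → x ≃ x
  theory (≃-refl {x}) = free (names x)
  name     (namesˡ ≃-refl) s   = id
  name-env (namesˡ ≃-refl) s n = PT.≈-refl s
  namesʳ (≃-refl {x}) = namesˡ (≃-refl {x})
  agree  ≃-refl m = refl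

  ≃-sym : ∀ {x y} → x ≃ y → y ≃ x
  theory (≃-sym p) = theory p
  namesˡ (≃-sym p) = namesʳ p
  namesʳ (≃-sym p) = namesˡ p
  agree  (≃-sym p) m = sym (agree p m)

  -- Gluing over the names of `y` makes both theories evaluate `y` at valuations that are pointwise
  -- equal; `ext` turns this into equality of values.
  ≃-trans : ∀ {x y z} → x ≃ y → y ≃ z → x ≃ z
  ≃-trans {x} {y} {z} p q = record
    { theory = G.glue
    ; namesˡ = inl ∘⇒ namesˡ p
    ; namesʳ = inr ∘⇒ namesʳ q
    ; agree  = λ m → trans (agree p (G.model₁ m)) (trans (ext y (G.models-agree m)) (agree q (G.model₂ m)))
    }
    where module G = Glue (names y) (theory p) (theory q) (namesʳ p) (namesˡ q)

  lift : BinOp → Op₂ Elem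
  names (lift o x y) = names x ⊞ names y
  fn    (lift o x y) v = operation C₄ o (fn x λ s → v s ∘ inj₁) (fn y λ s → v s ∘ inj₂)
  ext   (lift o x y) h = cong₂ (operation C₄ o) (ext x (λ s n → h s (inj₁ n))) (ext y (λ s n → h s (inj₂ n)))

  lift-cong : ∀ o {x x′ y y′} → x ≃ x′ → y ≃ y′ → lift o x y ≃ lift o x′ y′
  lift-cong o p q = record
    { theory = G.glue
    ; namesˡ = copair (inl ∘⇒ namesˡ p) (inr ∘⇒ namesˡ q)
    ; namesʳ = copair (inl ∘⇒ namesʳ p) (inr ∘⇒ namesʳ q)
    ; agree  = λ m → cong₂ (operation C₄ o) (agree p (G.model₁ m)) (agree q (G.model₂ m))
    }
    -- The two agreements concern separate operands, so no names have to be identified.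
    where module G = Glue ∅ (theory p) (theory q) ∅⇒ ∅⇒

  unit : Elem
  names unit   = ∅
  fn    unit _ = C₄.e
  ext   unit _ = refl

  evalE : (N → Elem) → Tm N → Elem
  evalE = fold lift unit

  module _ {Δ : Ctx} (ρ : N → Elem) (nm : ∀ n → names (ρ n) ⇒ Δ) where

    -- `lift` gives every occurrence of a variable its own copy of the names; these renamings merge
    -- the copies.
    namesₜ : ∀ t → names (evalE ρ t) ⇒ Δ
    namesₜ (var n)    = nm n
    namesₜ (op o s t) = copair (namesₜ s) (namesₜ t)
    namesₜ one        = ∅⇒

    fn-evalE : ∀ t (v : Val Δ) →
               fn (evalE ρ t) (pull (namesₜ t) v) ≡ eval₄ (λ n → fn (ρ n) (pull (nm n) v)) t
    fn-evalE (var n)    v = refl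
    fn-evalE (op o s t) v = cong₂ (operation C₄ o) (fn-evalE s v) (fn-evalE t v)
    fn-evalE one        v = refl

  -- An identity of `C₄` holds at every valuation, so the theory only has to supply common names for
  -- the values of `ρ`.
  identity : (p q : Tm (Fin k)) → (∀ σ → eval₄ σ p ≡ eval₄ σ q) → ∀ ρ → evalE ρ p ≃ evalE ρ q
  identity p q p≡q ρ = record
    { theory = free (⨁ (names ∘ ρ))
    ; namesˡ = namesₜ ρ (inject (names ∘ ρ)) p
    ; namesʳ = namesₜ ρ (inject (names ∘ ρ)) q
    ; agree  = λ m → trans (fn-evalE ρ _ p (val m)) (trans (p≡q _) (sym (fn-evalE ρ _ q (val m))))
    }

  -- The maps from `B` and `C` into the amalgam

  embed : ∀ s → T.Carrier s → Elem
  shape (names (embed s x)) r = r ≐ s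
  env   (names (embed s x)) _ refl = x
  fn    (embed s x) v = v s refl
  ext   (embed s x) h = h s refl

  -- The equation, written in names for the values of `x`, is true on side `s` and may therefore
  -- serve as its constraint. That `embed s` respects equality and the operations follows by
  -- instances.
  diagram : ∀ s (x : Fin k → T.Carrier s) (p q : Tm (Fin k)) →
            (let open T s in evalₜ (T s) x p ≈ evalₜ (T s) x q) →
            evalE (embed s ∘ x) p ≃ evalE (embed s ∘ x) q
  diagram {k} s x p q p≈q = record
    { theory = constrained Γ con′ holds′
    ; namesˡ = namesₜ ρ nm p
    ; namesʳ = namesₜ ρ nm q
    ; agree  = λ m → trans (fn-evalE ρ nm p (val m)) (trans (agree′ m) (sym (fn-evalE ρ nm q (val m))))
    }
    where
    ρ = embed s ∘ x
    Γ = ⨁ (names ∘ ρ)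
    nm = inject (names ∘ ρ)

    named : Tm (Fin k) → Tm (El (shape Γ s))
    named = rename (λ j → name (nm j) s refl)

    clause : ∀ r → r ≡ s → Tm (El (shape Γ r))
    clause r refl = eq (named p) (named q)

    -- Over the leaf `r ≐ s`, `every` imposes the clause on side `s` and leaves the trivial
    -- constraint `one` on the other.
    con′ : ∀ r → Tm (El (shape Γ r))
    con′ r = every (r ≐ s) (clause r)

    named-eval : ∀ t → let open T s in evalₜ (T s) (env Γ s) (named t) ≈ evalₜ (T s) x t
    named-eval t = PT.evalₜ-rename s {ρ = env Γ s} {ρ′ = x} t (λ j → name (nm j) s refl) (λ j → name-env (nm j) s refl)

    holds′ : ∀ r → let open T r in evalₜ (T r) (env Γ r) (con′ r) ≈ ε
    holds′ r = VT.every-≈ε r (shape Γ r) (r ≐ s) (clause r) λ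
      { refl → VT.eq-≈ε s (shape Γ s) (named p) (named q)
          (PT.≈-trans s (named-eval p) (PT.≈-trans s p≈q (PT.≈-sym s (named-eval q)))) }

    agree′ : (m : Model (constrained Γ con′ holds′)) →
             eval₄ (λ j → val m s (name (nm j) s refl)) p ≡ eval₄ (λ j → val m s (name (nm j) s refl)) q
    agree′ m = trans (sym (eval₄-rename p _ (λ _ → refl)))
      (trans (eq-elim (val m s) (named p) (named q)
        (every-elim (s ≐ s) (clause s) (val m s) (constrained-sat con′ holds′ m s) refl))
        (eval₄-rename q _ (λ _ → refl)))

  -- A single base name for `x` mediates: the constraint of each side equates its own name for the
  -- image of `x` with the base name, whose value is shared.
  amalgamates : ∀ x → embed true (I.⟦_⟧ true x) ≃ embed false (I.⟦_⟧ false x)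
  amalgamates x = record
    { theory = Δ
    ; namesˡ = inl
    ; namesʳ = inr
    ; agree  = λ m → trans
        (eq-elim [ val m true , bval m ] (var (inj₁ (inj₁ refl))) (var (inj₂ refl)) (sat m true))
        (sym (eq-elim [ val m false , bval m ] (var (inj₁ (inj₂ refl))) (var (inj₂ refl)) (sat m false)))
    }
    where
    Δ : Theory
    ctx   Δ       = names (embed true (I.⟦_⟧ true x)) ⊞ names (embed false (I.⟦_⟧ false x))
    base  Δ       = true ≐ true
    benv  Δ _     = x
    con   Δ true  = eq (var (inj₁ (inj₁ refl))) (var (inj₂ refl))
    con   Δ false = eq (var (inj₁ (inj₂ refl))) (var (inj₂ refl))
    holds Δ true  = VT.eq-≈ε true (shape (ctx Δ) true ⊕ base Δ)
      (var (inj₁ (inj₁ refl))) (var (inj₂ refl))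
      {[ env (ctx Δ) true , I.⟦_⟧ true ∘ benv Δ ]} (PT.≈-refl true)
    holds Δ false = VT.eq-≈ε false (shape (ctx Δ) false ⊕ base Δ)
      (var (inj₁ (inj₂ refl))) (var (inj₂ refl))
      {[ env (ctx Δ) false , I.⟦_⟧ false ∘ benv Δ ]} (PT.≈-refl false)

  private
    three : ∀ {b} {X : Set b} → X → X → X → Fin 3 → X
    three x y z 0F = x
    three x y z 1F = y
    three x y z 2F = z

    x₀ x₁ x₂ : Tm (Fin 3)
    x₀ = var 0F
    x₁ = var 1F
    x₂ = var 2F

  cong-embed : ∀ s {x y} → (let open T s in x ≈ y) → embed s x ≃ embed s y
  cong-embed s {x} {y} x≈y = diagram s (three x y x) x₀ x₁ x≈y

  embed-operation : ∀ s o x y →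
    embed s (operation (T s) o x y) ≃ lift o (embed s x) (embed s y)
  embed-operation s o x y =
    diagram s (three (operation (T s) o x y) x y) x₀ (op o x₁ x₂) (PT.≈-refl s)

  embed-unit : ∀ s → embed s (T.ε s) ≃ unit
  embed-unit s = diagram s (three (T.ε s) (T.ε s) (T.ε s)) x₀ one (PT.≈-refl s)

  -- Injectivity of the embeddings

  choose : {P : Bool → Set} → ∀ s → P s → P (not s) → ∀ r → P r
  choose true  p q true  = p
  choose true  p q false = q
  choose false p q true  = q
  choose false p q false = p

  choose-same : {P : Bool → Set} → ∀ s (p : P s) (q : P (not s)) → choose {P} s p q s ≡ p
  choose-same true  p q = refl
  choose-same false p q = refl

  evalₜ-i : ∀ s (ρ : N → A.Carrier) t →
            let open T s in evalₜ (T s) (I.⟦_⟧ s ∘ ρ) t ≈ I.⟦_⟧ s (evalₜ A ρ t)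
  evalₜ-i s ρ (var n)    = PT.≈-refl s
  evalₜ-i s ρ (op o t u) =
    PT.≈-trans s (PT.operation-cong s o (evalₜ-i s ρ t) (evalₜ-i s ρ u)) (PT.≈-sym s (homo o _ _))
    where
    homo : ∀ o x y → let open T s in
           I.⟦_⟧ s (operation A o x y) ≈ operation (T s) o (I.⟦_⟧ s x) (I.⟦_⟧ s y)
    homo meet  = I.∧-homo s
    homo join  = I.∨-homo s
    homo mult  = I.∙-homo s
    homo under = I.\\-homo s
    homo over  = I.//-homo s
  evalₜ-i s ρ one = PT.≈-sym s (I.ε-homo s)

  -- Injectivity of the embedding into side `r` reflects the equation to `A`, and the embedding into
  -- side `s` preserves it.
  transport : ∀ r s (ρ : N → A.Carrier) t →
              (let open T r in evalₜ (T r) (I.⟦_⟧ r ∘ ρ) t ≈ ε) →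
              let open T s in evalₜ (T s) (I.⟦_⟧ s ∘ ρ) t ≈ ε
  transport r s ρ t h = PT.≈-trans s (evalₜ-i s ρ t) (PT.≈-trans s
    (I.cong s (I.injective r (PT.≈-trans r (PT.≈-sym r (evalₜ-i r ρ t)) (PT.≈-trans r h (PT.≈-sym r (I.ε-homo r))))))
    (I.ε-homo s))

  -- Eliminating the names of the other side from its constraint leaves a constraint on the base
  -- names, which is true in A and hence on side s.
  embed-injective : ∀ s {x y} → embed s x ≃ embed s y → let open T s in x ≈ y
  embed-injective s {x} {y} p =
    ≈-trans (≈-sym (name-env (namesˡ p) s refl)) (≈-trans
      (VT.quasi-identity s S (and (con Δ s) kept) left right valid (full Δ s)
        (VT.and-≈ε s S (con Δ s) kept (holds Δ s) kept-holds))
      (name-env (namesʳ p) s refl))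
    where
    open PT s
    Δ = theory p
    s′ = not s
    S = shape (ctx Δ) s ⊕ base Δ
    S′ = shape (ctx Δ) s′

    interpolant : Tm (El (base Δ))
    interpolant = eliminate S′ (base Δ) (con Δ s′)

    -- On `C₄` the constraint implies the interpolant, so `quasi-identity` carries its truth over to
    -- the named elements.
    interpolant-holds : let open T s′ in evalₜ (T s′) (I.⟦_⟧ s′ ∘ benv Δ) interpolant ≈ ε
    interpolant-holds = PT.≈-trans s′
      (PT.≈-sym s′ (PT.evalₜ-rename s′ {ρ = full Δ s′} interpolant inj₂ (λ _ → PT.≈-refl s′)))
      (VT.quasi-identity s′ (S′ ⊕ base Δ) (con Δ s′) (rename inj₂ interpolant) one
        (λ σ h → trans (eval₄-rename interpolant inj₂ (λ _ → refl))
          (eliminate-intro S′ (base Δ) (con Δ s′) (σ ∘ inj₁) (σ ∘ inj₂)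
            (trans (eval₄-cong (λ { (inj₁ _) → refl ; (inj₂ _) → refl }) (con Δ s′)) h)))
        (full Δ s′) (holds Δ s′))

    kept : Tm (El S)
    kept = rename inj₂ interpolant

    kept-holds : let open T s in evalₜ (T s) (full Δ s) kept ≈ ε
    kept-holds = ≈-trans (evalₜ-rename {ρ = full Δ s} interpolant inj₂ (λ _ → ≈-refl))
      (transport s′ s (benv Δ) interpolant interpolant-holds)

    left right : Tm (El S)
    left  = var (inj₁ (name (namesˡ p) s refl))
    right = var (inj₁ (name (namesʳ p) s refl))

    -- Truth of `kept` supplies values for the names of the other side, which extends `σ` to a model
    -- of `Δ`; there `agree p` applies.
    valid : ∀ σ → eval₄ σ (and (con Δ s) kept) ≡ C₄.e → eval₄ σ left ≡ eval₄ σ right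
    valid σ h =
      trans (sym (at-s (name (namesˡ p) s refl))) (trans (agree p m) (at-s (name (namesʳ p) s refl)))
      where
      both = and-elim σ (con Δ s) kept h

      Local : Bool → Set
      Local r = Σ[ v ∈ (El (shape (ctx Δ) r) → Fin 4) ] eval₄ [ v , σ ∘ inj₂ ] (con Δ r) ≡ C₄.e

      here : Local s
      here = σ ∘ inj₁ ,
        trans (eval₄-cong (λ { (inj₁ _) → refl ; (inj₂ _) → refl }) (con Δ s)) (proj₁ both)

      there : Local s′
      there = eliminate-elim S′ (base Δ) (con Δ s′) (σ ∘ inj₂)
        (trans (sym (eval₄-rename interpolant inj₂ (λ _ → refl))) (proj₂ both))

      local : ∀ r → Local r
      local = choose {Local} s here there

      m : Model Δ
      val  m r = proj₁ (local r)
      bval m   = σ ∘ inj₂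
      sat  m r = proj₂ (local r)

      at-s : ∀ n → val m s n ≡ σ (inj₁ n)
      at-s n = cong (λ l → proj₁ l n) (choose-same {Local} s here there)

  -- The residuated lattice structure of the amalgam

  private
    module L = IsLattice C₄.isLattice
    module M = IsMonoid C₄.isMonoid

    law : (p q : Tm (Fin 3)) → (∀ σ → eval₄ σ p ≡ eval₄ σ q) →
          ∀ x y z → evalE (three x y z) p ≃ evalE (three x y z) q
    law p q p≡q x y z = identity p q p≡q (three x y z)

  _∧ᴱ_ _∨ᴱ_ _∙ᴱ_ _\\ᴱ_ _//ᴱ_ : Op₂ Elem
  _∧ᴱ_  = lift meet
  _∨ᴱ_  = lift join
  _∙ᴱ_  = lift mult
  _\\ᴱ_ = lift under
  _//ᴱ_ = lift over

  infix 4 _≤ᴱ_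

  _≤ᴱ_ : Elem → Elem → Set (a ⊔ ℓ)
  x ≤ᴱ y = x ≃ (x ∧ᴱ y)

  ≤ᴱ-respˡ : ∀ {x y z} → x ≃ y → y ≤ᴱ z → x ≤ᴱ z
  ≤ᴱ-respˡ p q = ≃-trans p (≃-trans q (lift-cong meet (≃-sym p) ≃-refl))

  private
    _∧ᵗ_ _∨ᵗ_ _∙ᵗ_ _\\ᵗ_ _//ᵗ_ : Op₂ (Tm (Fin 3))
    _∧ᵗ_  = op meet
    _∨ᵗ_  = op join
    _∙ᵗ_  = op mult
    _\\ᵗ_ = op under
    _//ᵗ_ = op over

  \\ᴱ-residuated : ∀ x y z → (y ≤ᴱ (x \\ᴱ z)) ⇔ ((x ∙ᴱ y) ≤ᴱ z)
  \\ᴱ-residuated x y z = mk⇔ to from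
    where
    to : y ≤ᴱ (x \\ᴱ z) → (x ∙ᴱ y) ≤ᴱ z
    -- Residuation is an equivalence, but `law` supplies only identities. So `h` is used to rewrite
    -- `y` as its meet with the residual, after which the counit identity applies.
    to h = ≤ᴱ-respˡ
      (lift-cong mult ≃-refl h)
      (law t (t ∧ᵗ x₂) (λ σ → \\-counit (σ 0F) (σ 1F) (σ 2F)) x y z)
      where t = x₀ ∙ᵗ (x₁ ∧ᵗ (x₀ \\ᵗ x₂))

    from : (x ∙ᴱ y) ≤ᴱ z → y ≤ᴱ (x \\ᴱ z)
    -- The unit identity puts `y` below the residual of `x ∙ y` by `x`; `h` replaces this product by
    -- its meet with `z`, and the last identity passes from the meet to `z`.
    from h = ≤ᴱ-respˡ
      (≃-trans
        (law x₁ (x₁ ∧ᵗ (x₀ \\ᵗ (x₀ ∙ᵗ x₁))) (λ σ → \\-unit (σ 0F) (σ 1F)) x y z)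
        (lift-cong meet ≃-refl
          (lift-cong under ≃-refl h)))
      (law t (t ∧ᵗ (x₀ \\ᵗ x₂)) (λ σ → \\-mono-∧ (σ 0F) (σ 1F) (σ 2F)) x y z)
      where t = x₁ ∧ᵗ (x₀ \\ᵗ ((x₀ ∙ᵗ x₁) ∧ᵗ x₂))

  //ᴱ-residuated : ∀ x y z → ((x ∙ᴱ y) ≤ᴱ z) ⇔ (x ≤ᴱ (z //ᴱ y))
  //ᴱ-residuated x y z = mk⇔ to from
    where
    to : (x ∙ᴱ y) ≤ᴱ z → x ≤ᴱ (z //ᴱ y)
    to h = ≤ᴱ-respˡ
      (≃-trans
        (law x₀ (x₀ ∧ᵗ ((x₀ ∙ᵗ x₁) //ᵗ x₁)) (λ σ → //-unit (σ 0F) (σ 1F)) x y z)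
        (lift-cong meet ≃-refl
          (lift-cong over h ≃-refl)))
      (law t (t ∧ᵗ (x₂ //ᵗ x₁)) (λ σ → //-mono-∧ (σ 0F) (σ 1F) (σ 2F)) x y z)
      where t = x₀ ∧ᵗ (((x₀ ∙ᵗ x₁) ∧ᵗ x₂) //ᵗ x₁)

    from : x ≤ᴱ (z //ᴱ y) → (x ∙ᴱ y) ≤ᴱ z
    from h = ≤ᴱ-respˡ
      (lift-cong mult h ≃-refl)
      (law t (t ∧ᵗ x₂) (λ σ → //-counit (σ 0F) (σ 1F) (σ 2F)) x y z)
      where t = (x₀ ∧ᵗ (x₂ //ᵗ x₁)) ∙ᵗ x₁

  ≃-isEquivalence : IsEquivalence _≃_
  ≃-isEquivalence = record { refl = ≃-refl ; sym = ≃-sym ; trans = ≃-trans }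

  -- Equality asks for a theory, which contains elements and equality proofs, and so lives at level
  -- `a ⊔ ℓ`. This level is unchanged when `ℓ` is already of the form `a ⊔ ℓ′`.
  D : ResiduatedLattice a (a ⊔ ℓ)
  D = record
    { Carrier = Elem
    ; _≈_     = _≃_
    ; _∧_     = _∧ᴱ_
    ; _∨_     = _∨ᴱ_
    ; _∙_     = _∙ᴱ_
    ; _\\_    = _\\ᴱ_
    ; _//_    = _//ᴱ_
    ; ε       = unit
    ; isLattice = record
      { isEquivalence = ≃-isEquivalence
      ; ∨-comm  = λ x y → law (x₀ ∨ᵗ x₁) (x₁ ∨ᵗ x₀) (λ σ → L.∨-comm (σ 0F) (σ 1F)) x y unit
      ; ∨-assoc = law ((x₀ ∨ᵗ x₁) ∨ᵗ x₂) (x₀ ∨ᵗ (x₁ ∨ᵗ x₂)) (λ σ → L.∨-assoc (σ 0F) (σ 1F) (σ 2F))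
      ; ∨-cong  = lift-cong join
      ; ∧-comm  = λ x y → law (x₀ ∧ᵗ x₁) (x₁ ∧ᵗ x₀) (λ σ → L.∧-comm (σ 0F) (σ 1F)) x y unit
      ; ∧-assoc = law ((x₀ ∧ᵗ x₁) ∧ᵗ x₂) (x₀ ∧ᵗ (x₁ ∧ᵗ x₂)) (λ σ → L.∧-assoc (σ 0F) (σ 1F) (σ 2F))
      ; ∧-cong  = lift-cong meet
      ; absorptive =
          (λ x y → law (x₀ ∨ᵗ (x₀ ∧ᵗ x₁)) x₀ (λ σ → proj₁ L.absorptive (σ 0F) (σ 1F)) x y unit) ,
          (λ x y → law (x₀ ∧ᵗ (x₀ ∨ᵗ x₁)) x₀ (λ σ → proj₂ L.absorptive (σ 0F) (σ 1F)) x y unit)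
      }
    ; isMonoid = record
      { isSemigroup = record
        { isMagma = record { isEquivalence = ≃-isEquivalence ; ∙-cong = lift-cong mult }
        ; assoc   = law ((x₀ ∙ᵗ x₁) ∙ᵗ x₂) (x₀ ∙ᵗ (x₁ ∙ᵗ x₂)) (λ σ → M.assoc (σ 0F) (σ 1F) (σ 2F))
        }
      ; identity =
          (λ x → law (one ∙ᵗ x₀) x₀ (λ σ → M.identityˡ (σ 0F)) x unit unit) ,
          (λ x → law (x₀ ∙ᵗ one) x₀ (λ σ → M.identityʳ (σ 0F)) x unit unit)
      }
    ; \\-residuated = \\ᴱ-residuated
    ; //-residuated = //ᴱ-residuated
    }

  -- Membership of the amalgam in the variety

  eval-D : (ρ : ℕ → Elem) (t : Tm (Fin k)) → eval D ρ (toTerm toℕ t) ≡ evalE (ρ ∘ toℕ) t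
  eval-D ρ t = trans (eval-toTerm D ρ toℕ t) (fold-congᵒ
    -- `operation D o` reduces to `lift o` only when `o` is a constructor.
    (λ { meet _ _ → refl ; join _ _ → refl ; mult _ _ → refl ; under _ _ → refl ; over _ _ → refl })
    unit (ρ ∘ toℕ) t)

  satisfies : (p q : Tm (Fin k)) →
              Satisfies C₄ (toTerm toℕ p , toTerm toℕ q) → Satisfies D (toTerm toℕ p , toTerm toℕ q)
  satisfies p q p≡q ρ =
    subst₂ _≃_ (sym (eval-D ρ p)) (sym (eval-D ρ q)) (identity p q valid (ρ ∘ toℕ))
    where
    finite : ∀ σ r → eval₄ σ r ≡ eval C₄ (extendFin C₄.e σ) (toTerm toℕ r)
    finite σ r = sym (trans (eval-toTerm C₄ (extendFin C₄.e σ) toℕ r)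
      (eval₄-cong (extendFin-toℕ C₄.e σ) r))

    valid : ∀ σ → eval₄ σ p ≡ eval₄ σ q
    valid σ = trans (finite σ p) (trans (p≡q (extendFin C₄.e σ)) (sym (finite σ q)))

  D∈V : D ∈ V C₄
  D∈V E C₄∈E {s , t} st∈E =
    -- Both terms must use the same `Fin k`, so `k` is the maximum of their bounds.
    let p , p≡s = fromTerm s (m≤m⊔n (bound s) (bound t))
        q , q≡t = fromTerm t (m≤n⊔m (bound s) (bound t))
    in subst₂ (λ s t → Satisfies C₄ (s , t) → Satisfies D (s , t)) p≡s q≡t (satisfies p q) (C₄∈E st∈E)

  j : ∀ s → Embedding (T s) D
  j s = record
    { ⟦_⟧         = embed s
    ; isEmbedding = record
      { isRelMonomorphism = record
        { isHomomorphism = record { cong = cong-embed s }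
        ; injective      = embed-injective s
        }
      ; ∧-homo  = embed-operation s meet
      ; ∨-homo  = embed-operation s join
      ; ∙-homo  = embed-operation s mult
      ; \\-homo = embed-operation s under
      ; //-homo = embed-operation s over
      ; ε-homo  = embed-unit s
      }
    }

theorem6p8 : (a ℓ : Level) → AmalgamationProperty {a} {a ⊔ ℓ} (V C₄)
theorem6p8 a ℓ A B C A∈V B∈V C∈V i₁ i₂ = D , D∈V , j true , j false , amalgamates
  where open Amalgam A B C B∈V C∈V i₁ i₂
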